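{- Let $A_1=C_7(1,2)$ and $A_2=\overline{C_3+C_4}$. For every $n\ge 2$, $\chi_{la}(A_1\vee O_{2n-1})=5$ and $\chi_{la}(A_2\vee O_{2n-1})=4$.
   Context: $C_7(1,2)$ is the circulant graph on $\mathbb{Z}_7$ in which $i,j$ are adjacent iff their cyclic distance is 1 or 2. $\overline{C_3+C_4}$ is the complement of the disjoint union of a 3-cycle and a 4-cycle. $O_n$ is the edgeless graph on $n$ vertices, and the join $G\vee H$ of vertex-disjoint graphs has vertex set $V(G)\cup V(H)$ and edge set $E(G)\cup E(H)\cup\{uv:u\in V(G),v\in V(H)\}$. For a simple graph with $q$ edges, a bijection $f:E\to\{1,\dots,q\}$ is a local antimagic labeling if $f^+(u)\neq f^+(v)$ for every edge $uv$, where $f^+(u)=\sum_{e\ni u} f(e)$; $\chi_{la}$ is the minimum number of distinct values of $f^+$ over all local antimagic labelings. -}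

module Defs where

open import Data.Bool using (Bool; true; false; _∧_; _∨_; not; if_then_else_)
open import Data.Nat using (ℕ; zero; suc; _+_; _*_; _∸_; _≤_; _<ᵇ_; _≡ᵇ_; _%_)
open import Data.Nat.Properties using () renaming (_≟_ to _≟ℕ_)
open import Data.Fin using (Fin; toℕ; splitAt)
open import Data.Fin.Properties using (all?) renaming (_≟_ to _≟F_)
open import Data.Sum using (_⊎_; inj₁; inj₂)
open import Data.Product using (_×_; _,_; proj₁; proj₂; Σ; ∃)
open import Data.List using (List; length; lookup; allFin; filterᵇ; cartesianProduct; map; deduplicate)
open import Data.Nat.ListAction using (sum)
open import Relation.Nullary using (¬_; does)
open import Relation.Nullary.Decidable using (toWitness; True)
open import Data.Bool.Properties using () renaming (_≟_ to _≟B_)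
open import Data.Unit using (tt)
open import Data.Bool using (T)
open import Relation.Binary.PropositionalEquality using (_≡_; refl)
open import Function.Definitions using (Injective)

record Graph (N : ℕ) : Set where
  field
    adj   : Fin N → Fin N → Bool
    sym   : ∀ i j → adj i j ≡ adj j i
    irrefl : ∀ i → adj i i ≡ false
open Graph public

edges : ∀ {N} → Graph N → List (Fin N × Fin N)
edges {N} G = filterᵇ (λ p → (toℕ (proj₁ p) <ᵇ toℕ (proj₂ p)) ∧ adj G (proj₁ p) (proj₂ p))
                      (cartesianProduct (allFin N) (allFin N))

size : ∀ {N} → Graph N → ℕ
size G = length (edges G)

-- An edge labeling assigns a natural number to each edge (indexed by position
-- in the edge list).
Labeling : ∀ {N} → Graph N → Set
Labeling G = Fin (size G) → ℕ

-- f is a bijection from E onto {1,…,q}: injective with all values in [1,q]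
-- (an injection of a q-element set into a q-element set is a bijection).
IsBijectiveLabeling : ∀ {N} (G : Graph N) → Labeling G → Set
IsBijectiveLabeling G f =
  Injective _≡_ _≡_ f × (∀ e → 1 ≤ f e × f e ≤ size G)

incident : ∀ {N} → Fin N → Fin N × Fin N → Bool
incident u (a , b) = does (u ≟F a) ∨ does (u ≟F b)

vsum : ∀ {N} (G : Graph N) → Labeling G → Fin N → ℕ
vsum G f u = sum (map (λ e → if incident u (lookup (edges G) e) then f e else 0)
                      (allFin (size G)))

IsLocalAntimagic : ∀ {N} (G : Graph N) → Labeling G → Set
IsLocalAntimagic G f =
  IsBijectiveLabeling G f ×
  (∀ e → ¬ (vsum G f (proj₁ (lookup (edges G) e)) ≡ vsum G f (proj₂ (lookup (edges G) e))))

numColors : ∀ {N} (G : Graph N) → Labeling G → ℕ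
numColors {N} G f = length (deduplicate _≟ℕ_ (map (vsum G f) (allFin N)))

ChiLa≡ : ∀ {N} → Graph N → ℕ → Set
ChiLa≡ G k =
  (Σ (Labeling G) λ f → IsLocalAntimagic G f × numColors G f ≡ k) ×
  (∀ f → IsLocalAntimagic G f → k ≤ numColors G f)

-- cyclic distance between i and j in Z_7 is 1 or 2
c712 : Fin 7 → Fin 7 → Bool
c712 i j = let d = (toℕ j + 7 ∸ toℕ i) % 7 in
  (d ≡ᵇ 1) ∨ (d ≡ᵇ 2) ∨ (d ≡ᵇ 5) ∨ (d ≡ᵇ 6)

-- C_3 + C_4 on Fin 7: vertices 0,1,2 form a triangle; 3-4-5-6-3 a 4-cycle
c3c4 : Fin 7 → Fin 7 → Bool
c3c4 i j = let a = toℕ i ; b = toℕ j in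
  ((a <ᵇ 3) ∧ (b <ᵇ 3) ∧ not (a ≡ᵇ b)) ∨
  (not (a <ᵇ 3) ∧ not (b <ᵇ 3) ∧
    (let d = (b + 4 ∸ a) % 4 in (d ≡ᵇ 1) ∨ (d ≡ᵇ 3)))

c3c4bar : Fin 7 → Fin 7 → Bool
c3c4bar i j = not (does (i ≟F j)) ∧ not (c3c4 i j)

sym7 : (r : Fin 7 → Fin 7 → Bool) →
       True (all? (λ i → all? (λ j → r i j ≟B r j i))) → ∀ i j → r i j ≡ r j i
sym7 r t = toWitness {a? = all? (λ i → all? (λ j → r i j ≟B r j i))} t

irr7 : (r : Fin 7 → Fin 7 → Bool) →
       True (all? (λ i → r i i ≟B false)) → ∀ i → r i i ≡ false
irr7 r t = toWitness {a? = all? (λ i → r i i ≟B false)} t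

mk7 : (r : Fin 7 → Fin 7 → Bool) →
      True (all? (λ i → all? (λ j → r i j ≟B r j i))) →
      True (all? (λ i → r i i ≟B false)) → Graph 7
mk7 r s i = record { adj = r ; sym = sym7 r s ; irrefl = irr7 r i }

A₁ : Graph 7
A₁ = mk7 c712 tt tt

A₂ : Graph 7
A₂ = mk7 c3c4bar tt tt

O : ∀ m → Graph m
O m = record { adj = λ _ _ → false ; sym = λ _ _ → refl ; irrefl = λ _ → refl }

joinAdj : ∀ {a b} → Graph a → Graph b → Fin (a + b) → Fin (a + b) → Bool
joinAdj {a} G H i j with splitAt a i | splitAt a j
... | inj₁ x | inj₁ y = adj G x y
... | inj₂ x | inj₂ y = adj H x y
... | inj₁ _ | inj₂ _ = true
... | inj₂ _ | inj₁ _ = true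

joinSym : ∀ {a b} (G : Graph a) (H : Graph b) i j → joinAdj G H i j ≡ joinAdj G H j i
joinSym {a} G H i j with splitAt a i | splitAt a j
... | inj₁ x | inj₁ y = sym G x y
... | inj₂ x | inj₂ y = sym H x y
... | inj₁ _ | inj₂ _ = refl
... | inj₂ _ | inj₁ _ = refl

joinIrr : ∀ {a b} (G : Graph a) (H : Graph b) i → joinAdj G H i i ≡ false
joinIrr {a} G H i with splitAt a i
... | inj₁ x = irrefl G x
... | inj₂ x = irrefl H x

_⋁_ : ∀ {a b} → Graph a → Graph b → Graph (a + b)
G ⋁ H = record { adj = joinAdj G H ; sym = joinSym G H ; irrefl = joinIrr G H }

{-# OPTIONS --safe #-}

-- Lower bounds.  A local antimagic labeling properly colours the graph, A₁ ∨ O_m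
-- has chromatic number 5, and A₂ ∨ O_m contains K₄.
--
-- Upper bounds.  Put m = 2k + 1, use the labels 1, …, 14 on the core A and the
-- other 7m labels on a 7 × m array (core vertices × outer vertices).  A label
-- 15 + 7v + s, 0 ≤ v ≤ 2k, 0 ≤ s ≤ 6, has quotient v and residue s.
-- The quotients in each row form a permutation of 0, …, 2k, and those in each
-- column sum to 7k: the rows are U, D, D, 2k − D, D′, D′, 2k − D′ with
-- U + D + D′ = 3k.  The residues rotate, within the row triples {1,2,3} and
-- {4,5,6}, according to |v − k| mod 3.  As |v − k| is unchanged by v ↦ 2k − v,
-- the label determines its row and hence its position.  All column sums agree,
-- and the row sums agree up to small offsets depending only on k mod 3; for each
-- of the three cases a labeling of A by 1, …, 14 turns these offsets into a
-- proper colouring of A with 4, respectively 3, colours.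

module Submission where

open import Defs
open import Algebra.Properties.CommutativeMonoid.Sum as Sum using ()
open import Data.Bool using (Bool; true; false; _∧_; if_then_else_; T)
open import Data.Bool.Properties using (T-∧; T-≡) renaming (_≟_ to _≟B_)
open import Data.Fin using (Fin; zero; suc; toℕ; fromℕ<; splitAt; join; opposite; combine; punchIn; punchOut; _↑ˡ_; _↑ʳ_)
open import Data.Fin.Patterns using (0F; 1F; 2F; 3F; 4F; 5F; 6F)
open import Data.Fin.Properties as Finₚ using (all?; injective⇒≤; toℕ<n; toℕ≤pred[n]; toℕ-fromℕ<; fromℕ<-injective; toℕ-injective; toℕ-↑ˡ; toℕ-↑ʳ; splitAt-↑ˡ; splitAt-↑ʳ; join-splitAt; punchIn-punchOut; punchOut-injective; opposite-prop; opposite-involutive; toℕ-combine; combine-injective) renaming (_≟_ to _≟F_)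
open import Data.List using (List; []; _∷_; _++_; length; lookup; allFin; filterᵇ; cartesianProduct; map; deduplicate; tabulate)
open import Data.List.Membership.Propositional using (_∈_)
open import Data.List.Membership.Propositional.Properties using (∈-lookup; ∈-filter⁺; ∈-filter⁻; ∈-cartesianProduct⁺; ∈-allFin; ∈-map⁺; ∈-map⁻; ∈-deduplicate⁺; ∈-deduplicate⁻)
open import Data.List.Properties using (map-∘; map-++; map-tabulate; tabulate-lookup; length-map)
open import Data.List.Relation.Binary.Subset.Propositional using (_⊆_)
open import Data.List.Relation.Unary.All as All using ([]; _∷_)
open import Data.List.Relation.Unary.AllPairs using (AllPairs; []; _∷_)
open import Data.List.Relation.Unary.AllPairs.Properties using () renaming (map⁺ to AllPairs-map⁺)
open import Data.List.Relation.Unary.Any using (index; here; there)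
open import Data.List.Relation.Unary.Any.Properties using (lookup-index)
open import Data.List.Relation.Unary.Unique.DecPropositional.Properties using (deduplicate-!)
open import Data.List.Relation.Unary.Unique.Propositional using (Unique)
open import Data.List.Relation.Unary.Unique.Propositional.Properties using (allFin⁺; filter⁺; cartesianProduct⁺)
open import Data.Nat using (ℕ; zero; suc; _+_; _*_; _∸_; _≤_; _<_; _<ᵇ_; s≤s; z≤n; z<s; ∣_-_∣)
open import Data.Nat.DivMod using (DivMod; _divMod_; result)
open import Data.Nat.ListAction using (sum)
open import Data.Nat.ListAction.Properties using (sum-++)
open import Data.Nat.Properties renaming (_≟_ to _≟ℕ_)
open import Data.Nat.Tactic.RingSolver using (solve-∀)
open import Data.Product using (_×_; _,_; proj₁; proj₂)
open import Data.Sum using (_⊎_; inj₁; inj₂)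
open import Data.Vec using (Vec; []; _∷_) renaming (lookup to _‼_)
open import Function using (_∘_; id; Equivalence)
open import Function.Definitions using (Injective)
open import Relation.Binary.Definitions using (tri<; tri≈; tri>)
open import Relation.Binary.PropositionalEquality as ≡ using (_≡_; _≢_; refl; cong; cong₂; subst; trans; module ≡-Reasoning)
open import Relation.Nullary using (Dec; ¬_; does; yes; no; contradiction)
open import Relation.Nullary.Decidable using (T?; map′; _×-dec_; _→-dec_; ¬?; from-yes)

open Sum +-0-commutativeMonoid using (sum-cong-≗; sum-remove; ∑-distrib-+; ∑-comm) renaming (sum to ∑)

private variable
  X : Set
  N n a : ℕ

-- Duplicate-free lists and finite sums.

lookup-injective : {xs : List X} → Unique xs → Injective _≡_ _≡_ (lookup xs)
lookup-injective (_  ∷ _) {zero}  {zero}  _  = refl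
lookup-injective (x∉ ∷ _) {zero}  {suc j} eq = contradiction eq (All.lookup x∉ (∈-lookup j))
lookup-injective (x∉ ∷ _) {suc i} {zero}  eq = contradiction (≡.sym eq) (All.lookup x∉ (∈-lookup i))
lookup-injective (_  ∷ u) {suc i} {suc j} eq = cong suc (lookup-injective u eq)

-- Sending each index of `xs` to the position in `ys` where its element is found is injective: the
-- element can be read back at that position, and `xs` has no repetitions.
Unique-⊆⇒length≤ : {xs ys : List X} → Unique xs → xs ⊆ ys → length xs ≤ length ys
Unique-⊆⇒length≤ {xs = xs} {ys} u xs⊆ys = injective⇒≤ {f = pos} λ {i} {j} eq →
  lookup-injective u (trans (lookup-index (xs⊆ys (∈-lookup i)))
    (trans (cong (lookup ys) eq) (≡.sym (lookup-index (xs⊆ys (∈-lookup j))))))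
  where
  pos : Fin (length xs) → Fin (length ys)
  pos i = index (xs⊆ys (∈-lookup i))

sum-allFin : (f : Fin n → ℕ) → sum (map f (allFin n)) ≡ ∑ f
sum-allFin f = trans (cong sum (map-tabulate id f)) (sum-tabulate f)
  where
  sum-tabulate : ∀ {n} (f : Fin n → ℕ) → sum (tabulate f) ≡ ∑ f
  sum-tabulate {zero}  f = refl
  sum-tabulate {suc n} f = cong (f zero +_) (sum-tabulate (f ∘ suc))

sum-lookup : (h : X → ℕ) (xs : List X) → sum (map (h ∘ lookup xs) (allFin (length xs))) ≡ sum (map h xs)
sum-lookup h xs = cong sum (trans (map-tabulate id (h ∘ lookup xs))
  (trans (≡.sym (map-tabulate (lookup xs) h)) (cong (map h) (tabulate-lookup xs))))

sum-filterᵇ : (h : X → ℕ) (p : X → Bool) (xs : List X) →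
              sum (map h (filterᵇ p xs)) ≡ sum (map (λ x → if p x then h x else 0) xs)
sum-filterᵇ h p []       = refl
sum-filterᵇ h p (x ∷ xs) with p x
... | true  = cong (h x +_) (sum-filterᵇ h p xs)
... | false = sum-filterᵇ h p xs

sum-cartesianProduct : {Y : Set} (h : X × Y → ℕ) (xs : List X) (ys : List Y) →
  sum (map h (cartesianProduct xs ys)) ≡ sum (map (λ x → sum (map (λ y → h (x , y)) ys)) xs)
sum-cartesianProduct h []       ys = refl
sum-cartesianProduct h (x ∷ xs) ys = begin
  sum (map h (map (x ,_) ys ++ cartesianProduct xs ys))
    ≡⟨ cong sum (map-++ h (map (x ,_) ys) _) ⟩
  sum (map h (map (x ,_) ys) ++ map h (cartesianProduct xs ys))
    ≡⟨ sum-++ (map h (map (x ,_) ys)) _ ⟩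
  sum (map h (map (x ,_) ys)) + sum (map h (cartesianProduct xs ys))
    ≡⟨ cong₂ _+_ (cong sum (≡.sym (map-∘ ys))) (sum-cartesianProduct h xs ys) ⟩
  sum (map (λ y → h (x , y)) ys) + sum (map (λ x → sum (map (λ y → h (x , y)) ys)) xs) ∎
  where open ≡-Reasoning

∑-const : (c : ℕ) (f : Fin n → ℕ) → (∀ i → f i ≡ c) → ∑ f ≡ n * c
∑-const {zero}  c f f≡c = refl
∑-const {suc n} c f f≡c = cong₂ _+_ (f≡c zero) (∑-const c (f ∘ suc) (f≡c ∘ suc))

∑-zero : (f : Fin n → ℕ) → (∀ i → f i ≡ 0) → ∑ f ≡ 0
∑-zero {n} f f≡0 = trans (∑-const 0 f f≡0) (*-zeroʳ n)

∑-δ : (u : Fin n) (f : Fin n → ℕ) → ∑ (λ i → if does (u ≟F i) then f i else 0) ≡ f u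
∑-δ {suc n} zero    f = trans (cong (f zero +_) (∑-zero {n} (λ _ → 0) (λ _ → refl))) (+-identityʳ (f zero))
∑-δ (suc u) f = ∑-δ u (f ∘ suc)

∑-↑ : ∀ {m} a (f : Fin (a + m) → ℕ) → ∑ f ≡ ∑ (λ x → f (x ↑ˡ m)) + ∑ (λ j → f (a ↑ʳ j))
∑-↑ zero    f = refl
∑-↑ (suc a) f = trans (cong (f zero +_) (∑-↑ a (f ∘ suc))) (≡.sym (+-assoc (f zero) _ _))

∑-last : (g : ℕ → ℕ) → ∑ {suc n} (g ∘ toℕ) ≡ ∑ {n} (g ∘ toℕ) + g n
∑-last {zero}  g = +-comm (g 0) 0
∑-last {suc n} g = trans (cong (g 0 +_) (∑-last {n} (g ∘ suc))) (≡.sym (+-assoc (g 0) _ _))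

-- An injective self-map of a finite set is a permutation, so it only reorders the summands. The
-- induction splits off the summand at `f zero` and closes the gap with `punchOut`, which leaves an
-- injective self-map of a set with one element fewer.
∑-injective : (f : Fin n → Fin n) → Injective _≡_ _≡_ f → (g : Fin n → ℕ) → ∑ (g ∘ f) ≡ ∑ g
∑-injective {zero}  f inj g = refl
∑-injective {suc n} f inj g = begin
  g (f zero) + ∑ (λ i → g (f (suc i)))
    ≡⟨ cong (g (f zero) +_) (sum-cong-≗ λ i → cong g (≡.sym (punchIn-punchOut (f0≢ i)))) ⟩
  g (f zero) + ∑ (λ i → g (punchIn (f zero) (punchOut (f0≢ i))))
    ≡⟨ cong (g (f zero) +_) (∑-injective (λ i → punchOut (f0≢ i))
         (λ {i} {j} eq → Finₚ.suc-injective (inj (punchOut-injective (f0≢ i) (f0≢ j) eq)))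
         (g ∘ punchIn (f zero))) ⟩
  g (f zero) + ∑ (λ i → g (punchIn (f zero) i))
    ≡⟨ sum-remove {i = f zero} g ⟨
  ∑ g ∎
  where
  open ≡-Reasoning
  f0≢ : ∀ i → f zero ≢ f (suc i)
  f0≢ i eq = Finₚ.0≢1+n (inj eq)

-- Edge lists and vertex sums.

isEdge : Graph N → Fin N × Fin N → Bool
isEdge G p = (toℕ (proj₁ p) <ᵇ toℕ (proj₂ p)) ∧ adj G (proj₁ p) (proj₂ p)

sum-edges : (G : Graph N) (h : Fin N × Fin N → ℕ) →
            sum (map h (edges G)) ≡ ∑ (λ i → ∑ (λ j → if isEdge G (i , j) then h (i , j) else 0))
sum-edges {N} G h = begin
  sum (map h (edges G))
    ≡⟨ sum-filterᵇ h (isEdge G) (cartesianProduct (allFin N) (allFin N)) ⟩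
  sum (map h′ (cartesianProduct (allFin N) (allFin N)))
    ≡⟨ sum-cartesianProduct h′ (allFin N) (allFin N) ⟩
  sum (map (λ i → sum (map (λ j → h′ (i , j)) (allFin N))) (allFin N))
    ≡⟨ sum-allFin (λ i → sum (map (λ j → h′ (i , j)) (allFin N))) ⟩
  ∑ (λ i → sum (map (λ j → h′ (i , j)) (allFin N)))
    ≡⟨ sum-cong-≗ (λ i → sum-allFin (λ j → h′ (i , j))) ⟩
  ∑ (λ i → ∑ (λ j → h′ (i , j))) ∎
  where
  open ≡-Reasoning
  h′ : Fin N × Fin N → ℕ
  h′ p = if isEdge G p then h p else 0

size-∑ : (G : Graph N) → size G ≡ ∑ (λ i → ∑ (λ j → if isEdge G (i , j) then 1 else 0))
size-∑ G = trans (length-sum (edges G)) (sum-edges G (λ _ → 1))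
  where
  length-sum : (xs : List X) → length xs ≡ sum (map (λ _ → 1) xs)
  length-sum []       = refl
  length-sum (_ ∷ xs) = cong suc (length-sum xs)

edges-Unique : (G : Graph N) → Unique (edges G)
edges-Unique {N} G = filter⁺ (T? ∘ isEdge G) (cartesianProduct⁺ (allFin⁺ N) (allFin⁺ N))

T⇒≡true : ∀ {b} → T b → b ≡ true
T⇒≡true = Equivalence.to T-≡

≡true⇒T : ∀ {b} → b ≡ true → T b
≡true⇒T = Equivalence.from T-≡

edge-lookup : (G : Graph N) (e : Fin (size G)) →
  let (i , j) = lookup (edges G) e in toℕ i < toℕ j × adj G i j ≡ true
edge-lookup {N} G e
  with l , r ← Equivalence.to T-∧ (proj₂ (∈-filter⁻ (T? ∘ isEdge G) {xs = cartesianProduct (allFin N) (allFin N)} (∈-lookup {xs = edges G} e)))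
  = <ᵇ⇒< _ _ l , T⇒≡true r

edge-∈ : (G : Graph N) {i j : Fin N} → toℕ i < toℕ j → adj G i j ≡ true → (i , j) ∈ edges G
edge-∈ G {i} {j} i<j ij = ∈-filter⁺ (T? ∘ isEdge G) (∈-cartesianProduct⁺ (∈-allFin i) (∈-allFin j))
  (Equivalence.from T-∧ (<⇒<ᵇ i<j , ≡true⇒T ij))

labelBy : (G : Graph N) → (Fin N → Fin N → ℕ) → Labeling G
labelBy G W e = W (proj₁ (lookup (edges G) e)) (proj₂ (lookup (edges G) e))

-- Each edge is stored once, smaller end first. Splitting the incidence test into its two ends turns
-- the sum over edges into two double sums with a Kronecker delta. These collapse to a row and a
-- column of `Y`, and for each `j` at most one of `Y u j` and `Y j u` comes from a stored edge.
vsum-labelBy : (G : Graph N) (W : Fin N → Fin N → ℕ) → (∀ i j → W i j ≡ W j i) →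
               ∀ u → vsum G (labelBy G W) u ≡ ∑ (λ j → if adj G u j then W u j else 0)
vsum-labelBy {N} G W W-sym u = begin
  vsum G (labelBy G W) u
    ≡⟨ sum-lookup (λ p → if incident u p then W (proj₁ p) (proj₂ p) else 0) (edges G) ⟩
  sum (map (λ p → if incident u p then W (proj₁ p) (proj₂ p) else 0) (edges G))
    ≡⟨ sum-edges G _ ⟩
  ∑ (λ i → ∑ (λ j → if isEdge G (i , j) then (if incident u (i , j) then W i j else 0) else 0))
    ≡⟨ sum-cong-≗ (λ i → trans (sum-cong-≗ (split i)) (∑-distrib-+ (λ j → if does (u ≟F i) then Y i j else 0) _)) ⟩
  ∑ (λ i → ∑ (λ j → if does (u ≟F i) then Y i j else 0) + ∑ (λ j → if does (u ≟F j) then Y i j else 0))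
    ≡⟨ ∑-distrib-+ (λ i → ∑ (λ j → if does (u ≟F i) then Y i j else 0)) _ ⟩
  ∑ (λ i → ∑ (λ j → if does (u ≟F i) then Y i j else 0)) + ∑ (λ i → ∑ (λ j → if does (u ≟F j) then Y i j else 0))
    ≡⟨ cong₂ _+_ (trans (∑-comm (λ i j → if does (u ≟F i) then Y i j else 0)) (sum-cong-≗ (λ j → ∑-δ u (λ i → Y i j))))
                 (sum-cong-≗ (λ i → ∑-δ u (Y i))) ⟩
  ∑ (λ j → Y u j) + ∑ (λ j → Y j u)
    ≡⟨ ∑-distrib-+ (Y u) (λ j → Y j u) ⟨
  ∑ (λ j → Y u j + Y j u)
    ≡⟨ sum-cong-≗ merge ⟩
  ∑ (λ j → if adj G u j then W u j else 0) ∎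
  where
  open ≡-Reasoning

  Y : Fin N → Fin N → ℕ
  Y i j = if isEdge G (i , j) then W i j else 0

  ≮⇒<ᵇ : ∀ {a b} → ¬ (a < b) → (a <ᵇ b) ≡ false
  ≮⇒<ᵇ {a} {b} a≮b with a <ᵇ b in eq
  ... | true  = contradiction (<ᵇ⇒< a b (≡true⇒T eq)) a≮b
  ... | false = refl

  Y-diag : ∀ i → Y i i ≡ 0
  Y-diag i rewrite ≮⇒<ᵇ {toℕ i} {toℕ i} (<-irrefl refl) = refl

  split : ∀ i j → (if isEdge G (i , j) then (if incident u (i , j) then W i j else 0) else 0)
                ≡ (if does (u ≟F i) then Y i j else 0) + (if does (u ≟F j) then Y i j else 0)
  split i j with u ≟F i | u ≟F j
  -- When `i` and `j` both equal `u`, the right side counts `Y u u` twice; this is harmless because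
  -- it is 0.
  ... | yes refl | yes refl rewrite Y-diag u = refl
  ... | yes refl | no _     = ≡.sym (+-identityʳ _)
  ... | no _     | yes refl = refl
  ... | no _     | no _ with isEdge G (i , j)
  ...   | true  = refl
  ...   | false = refl

  merge : ∀ j → Y u j + Y j u ≡ (if adj G u j then W u j else 0)
  merge j with <-cmp (toℕ u) (toℕ j)
  ... | tri< u<j _ j≮u rewrite T⇒≡true (<⇒<ᵇ u<j) | ≮⇒<ᵇ j≮u = +-identityʳ _
  ... | tri> u≮j _ j<u rewrite T⇒≡true (<⇒<ᵇ j<u) | ≮⇒<ᵇ u≮j | Graph.sym G j u | W-sym j u = refl
  ... | tri≈ _ eq _ with refl ← toℕ-injective {i = u} {j} eq
    rewrite ≮⇒<ᵇ {toℕ u} {toℕ u} (<-irrefl refl) | irrefl G u = refl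

edge⇒vsum≢ : (G : Graph N) (f : Labeling G) →
  (∀ e → vsum G f (proj₁ (lookup (edges G) e)) ≢ vsum G f (proj₂ (lookup (edges G) e))) →
  ∀ {i j} → (i , j) ∈ edges G → vsum G f i ≢ vsum G f j
edge⇒vsum≢ G f proper p = subst (λ (x , y) → vsum G f x ≢ vsum G f y) (≡.sym (lookup-index p)) (proper (index p))

-- `IsLocalAntimagic` speaks only of stored pairs, smaller end first; symmetry of `adj` covers the
-- other order and irreflexivity the diagonal.
adjacent⇒vsum≢ : (G : Graph N) (f : Labeling G) → IsLocalAntimagic G f →
                 ∀ i j → adj G i j ≡ true → vsum G f i ≢ vsum G f j
adjacent⇒vsum≢ G f (_ , proper) i j ij with <-cmp (toℕ i) (toℕ j)
... | tri< i<j _ _ = edge⇒vsum≢ G f proper (edge-∈ G i<j ij)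
... | tri> _ _ j<i = edge⇒vsum≢ G f proper (edge-∈ G j<i (trans (Graph.sym G j i) ij)) ∘ ≡.sym
... | tri≈ _ eq _ with refl ← toℕ-injective {i = i} {j} eq with () ← trans (≡.sym (irrefl G i)) ij

numColors-≥ : (G : Graph N) (f : Labeling G) (us : List (Fin N)) →
              AllPairs (λ i j → vsum G f i ≢ vsum G f j) us → length us ≤ numColors G f
numColors-≥ G f us distinct = subst (_≤ numColors G f) (length-map (vsum G f) us)
  (Unique-⊆⇒length≤ (AllPairs-map⁺ distinct) vsum∈)
  where
  vsum∈ : map (vsum G f) us ⊆ deduplicate _≟ℕ_ (map (vsum G f) (allFin _))
  vsum∈ p with u , _ , refl ← ∈-map⁻ (vsum G f) p = ∈-deduplicate⁺ _≟ℕ_ (∈-map⁺ (vsum G f) (∈-allFin u))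

numColors-≤ : (G : Graph N) (f : Labeling G) (palette : List ℕ) →
              (∀ u → vsum G f u ∈ palette) → numColors G f ≤ length palette
numColors-≤ G f palette vsum∈ = Unique-⊆⇒length≤ (deduplicate-! _≟ℕ_ (map (vsum G f) (allFin _))) inPalette
  where
  inPalette : deduplicate _≟ℕ_ (map (vsum G f) (allFin _)) ⊆ palette
  inPalette p with u , _ , refl ← ∈-map⁻ (vsum G f) (∈-deduplicate⁻ _≟ℕ_ (map (vsum G f) (allFin _)) p) = vsum∈ u

-- Joins with an edgeless graph.

data Side {a m : ℕ} : Fin (a + m) → Set where
  left  : (x : Fin a) → Side (x ↑ˡ m)
  right : (j : Fin m) → Side (a ↑ʳ j)

-- Matching on this view turns the vertex itself into `x ↑ˡ m` or `a ↑ʳ j`, the forms in which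
-- adjacency, weights and vertex sums of the join are computed.
side : ∀ {m} a (i : Fin (a + m)) → Side {a} {m} i
side {m} a i = subst Side (join-splitAt a m i) (ofSum (splitAt a i))
  where
  ofSum : (s : Fin a ⊎ Fin m) → Side {a} {m} (join a m s)
  ofSum (inj₁ x) = left x
  ofSum (inj₂ j) = right j

module _ (G : Graph a) (m : ℕ) where

  private
    J : Graph (a + m)
    J = G ⋁ O m

  adj-left-left : ∀ x y → adj J (x ↑ˡ m) (y ↑ˡ m) ≡ adj G x y
  adj-left-left x y rewrite splitAt-↑ˡ a x m | splitAt-↑ˡ a y m = refl

  adj-left-right : ∀ x j → adj J (x ↑ˡ m) (a ↑ʳ j) ≡ true
  adj-left-right x j rewrite splitAt-↑ˡ a x m | splitAt-↑ʳ a m j = refl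

  adj-right-left : ∀ j x → adj J (a ↑ʳ j) (x ↑ˡ m) ≡ true
  adj-right-left j x rewrite splitAt-↑ˡ a x m | splitAt-↑ʳ a m j = refl

  adj-right-right : ∀ i j → adj J (a ↑ʳ i) (a ↑ʳ j) ≡ false
  adj-right-right i j rewrite splitAt-↑ʳ a m i | splitAt-↑ʳ a m j = refl

  left<right : (x : Fin a) (j : Fin m) → toℕ (x ↑ˡ m) < toℕ (a ↑ʳ j)
  left<right x j rewrite toℕ-↑ˡ x m | toℕ-↑ʳ a j = <-≤-trans (toℕ<n x) (m≤m+n a (toℕ j))

  -- Edges are counted at their smaller end: a core vertex contributes its edges inside `G` and `m`
  -- cross edges, an outer vertex contributes nothing.
  size-join : size J ≡ size G + a * m
  size-join = begin
    size J
      ≡⟨ size-∑ J ⟩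
    ∑ (λ i → ∑ (λ j → E i j))
      ≡⟨ ∑-↑ a (λ i → ∑ (λ j → E i j)) ⟩
    ∑ (λ x → ∑ (λ j → E (x ↑ˡ m) j)) + ∑ (λ i → ∑ (λ j → E (a ↑ʳ i) j))
      ≡⟨ cong₂ _+_ (sum-cong-≗ leftRow) (∑-zero _ rightRow) ⟩
    ∑ (λ x → ∑ (λ y → if isEdge G (x , y) then 1 else 0) + m) + 0
      ≡⟨ +-identityʳ _ ⟩
    ∑ (λ x → ∑ (λ y → if isEdge G (x , y) then 1 else 0) + m)
      ≡⟨ ∑-distrib-+ (λ x → ∑ (λ y → if isEdge G (x , y) then 1 else 0)) _ ⟩
    ∑ (λ x → ∑ (λ y → if isEdge G (x , y) then 1 else 0)) + ∑ {a} (λ _ → m)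
      ≡⟨ cong₂ _+_ (≡.sym (size-∑ G)) (∑-const {a} m (λ _ → m) (λ _ → refl)) ⟩
    size G + a * m ∎
    where
    open ≡-Reasoning

    E : Fin (a + m) → Fin (a + m) → ℕ
    E i j = if isEdge J (i , j) then 1 else 0

    leftRow : ∀ x → ∑ (λ j → E (x ↑ˡ m) j) ≡ ∑ (λ y → if isEdge G (x , y) then 1 else 0) + m
    leftRow x = trans (∑-↑ a (E (x ↑ˡ m))) (cong₂ _+_ (sum-cong-≗ ll) (trans (∑-const 1 _ lr) (*-identityʳ m)))
      where
      ll : ∀ y → E (x ↑ˡ m) (y ↑ˡ m) ≡ (if isEdge G (x , y) then 1 else 0)
      ll y rewrite adj-left-left x y | toℕ-↑ˡ x m | toℕ-↑ˡ y m = refl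
      lr : ∀ j → E (x ↑ˡ m) (a ↑ʳ j) ≡ 1
      lr j rewrite adj-left-right x j | T⇒≡true (<⇒<ᵇ (left<right x j)) = refl

    rightRow : ∀ i → ∑ (λ j → E (a ↑ʳ i) j) ≡ 0
    rightRow i = trans (∑-↑ a (E (a ↑ʳ i))) (cong₂ _+_ (∑-zero _ rl) (∑-zero _ rr))
      where
      rl : ∀ x → E (a ↑ʳ i) (x ↑ˡ m) ≡ 0
      rl x with toℕ (a ↑ʳ i) <ᵇ toℕ (x ↑ˡ m) in eq
      ... | false = refl
      ... | true  = contradiction (<ᵇ⇒< (toℕ (a ↑ʳ i)) _ (≡true⇒T eq)) (<-asym (left<right x i))
      rr : ∀ j → E (a ↑ʳ i) (a ↑ʳ j) ≡ 0
      rr j with toℕ (a ↑ʳ i) <ᵇ toℕ (a ↑ʳ j)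
      ... | false = refl
      ... | true rewrite adj-right-right i j = refl

  module _ (w : Fin a → Fin a → ℕ) (M : Fin a → Fin m → ℕ) (w-sym : ∀ x y → w x y ≡ w y x) where

    joinWeight : Fin (a + m) → Fin (a + m) → ℕ
    joinWeight i j = weight (splitAt a i) (splitAt a j)
      where
      weight : Fin a ⊎ Fin m → Fin a ⊎ Fin m → ℕ
      weight (inj₁ x) (inj₁ y) = w x y
      weight (inj₁ x) (inj₂ j) = M x j
      weight (inj₂ j) (inj₁ x) = M x j
      -- A filler value: two outer vertices are never adjacent.
      weight (inj₂ _) (inj₂ _) = 0

    weight-left-left : ∀ x y → joinWeight (x ↑ˡ m) (y ↑ˡ m) ≡ w x y
    weight-left-left x y rewrite splitAt-↑ˡ a x m | splitAt-↑ˡ a y m = refl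

    weight-left-right : ∀ x j → joinWeight (x ↑ˡ m) (a ↑ʳ j) ≡ M x j
    weight-left-right x j rewrite splitAt-↑ˡ a x m | splitAt-↑ʳ a m j = refl

    weight-right-left : ∀ j x → joinWeight (a ↑ʳ j) (x ↑ˡ m) ≡ M x j
    weight-right-left j x rewrite splitAt-↑ˡ a x m | splitAt-↑ʳ a m j = refl

    joinWeight-sym : ∀ i j → joinWeight i j ≡ joinWeight j i
    joinWeight-sym i j with splitAt a i | splitAt a j
    ... | inj₁ x | inj₁ y = w-sym x y
    ... | inj₁ _ | inj₂ _ = refl
    ... | inj₂ _ | inj₁ _ = refl
    ... | inj₂ _ | inj₂ _ = refl

    joinLabel : Labeling J
    joinLabel = labelBy J joinWeight

    vsum-left : ∀ x → vsum J joinLabel (x ↑ˡ m) ≡ ∑ (λ y → if adj G x y then w x y else 0) + ∑ (M x)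
    vsum-left x = trans (vsum-labelBy J joinWeight joinWeight-sym (x ↑ˡ m))
      (trans (∑-↑ a _) (cong₂ _+_ (sum-cong-≗ ll) (sum-cong-≗ lr)))
      where
      ll : ∀ y → (if adj J (x ↑ˡ m) (y ↑ˡ m) then joinWeight (x ↑ˡ m) (y ↑ˡ m) else 0) ≡ (if adj G x y then w x y else 0)
      ll y rewrite adj-left-left x y | weight-left-left x y = refl
      lr : ∀ j → (if adj J (x ↑ˡ m) (a ↑ʳ j) then joinWeight (x ↑ˡ m) (a ↑ʳ j) else 0) ≡ M x j
      lr j rewrite adj-left-right x j = weight-left-right x j

    vsum-right : ∀ j → vsum J joinLabel (a ↑ʳ j) ≡ ∑ (λ x → M x j)
    vsum-right j = trans (vsum-labelBy J joinWeight joinWeight-sym (a ↑ʳ j))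
      (trans (∑-↑ a _) (trans (cong₂ _+_ (sum-cong-≗ rl) (∑-zero _ rr)) (+-identityʳ _)))
      where
      rl : ∀ x → (if adj J (a ↑ʳ j) (x ↑ˡ m) then joinWeight (a ↑ʳ j) (x ↑ˡ m) else 0) ≡ M x j
      rl x rewrite adj-right-left j x = weight-right-left j x
      rr : ∀ i → (if adj J (a ↑ʳ j) (a ↑ʳ i) then joinWeight (a ↑ʳ j) (a ↑ʳ i) else 0) ≡ 0
      rr i rewrite adj-right-right j i = refl

-- The residue pattern and sums symmetric about the centre.

phase : ℕ → Fin 3
phase 0 = 0F
phase 1 = 1F
phase 2 = 2F
phase (suc (suc (suc t))) = phase t

-- Indexed by row, then by phase. The residues are divided into 3 alone, 0, 4, 5 and 1, 2, 6. Both
-- triples have sum 9 and are arranged as cyclic Latin squares, so every phase uses each residue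
-- once, each row triple sums to 9 at a fixed phase, and each row sums to 9 over the three phases.
residues : Vec (Vec (Fin 7) 3) 7
residues =
  (3F ∷ 3F ∷ 3F ∷ []) ∷
  (4F ∷ 5F ∷ 0F ∷ []) ∷
  (5F ∷ 0F ∷ 4F ∷ []) ∷
  (0F ∷ 4F ∷ 5F ∷ []) ∷
  (2F ∷ 1F ∷ 6F ∷ []) ∷
  (1F ∷ 6F ∷ 2F ∷ []) ∷
  (6F ∷ 2F ∷ 1F ∷ []) ∷ []

residue : Fin 7 → Fin 3 → Fin 7
residue x p = (residues ‼ x) ‼ p

res : Fin 7 → Fin 3 → ℕ
res x p = toℕ (residue x p)

residue-injective : ∀ p x y → residue x p ≡ residue y p → x ≡ y
residue-injective = from-yes (all? λ p → all? λ x → all? λ y → (residue x p ≟F residue y p) →-dec (x ≟F y))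

res-sum₁ : ∀ p → res 1F p + res 2F p + res 3F p ≡ 9
res-sum₁ = from-yes (all? λ p → (res 1F p + res 2F p + res 3F p) ≟ℕ 9)

res-sum₂ : ∀ p → res 4F p + res 5F p + res 6F p ≡ 9
res-sum₂ = from-yes (all? λ p → (res 4F p + res 5F p + res 6F p) ≟ℕ 9)

res-row₀ : ∀ p → res 0F p ≡ 3
res-row₀ = from-yes (all? λ p → res 0F p ≟ℕ 3)

res-period : ∀ x t → res x (phase (1 + t)) + res x (phase (2 + t)) + res x (phase t) ≡ 9
res-period x 0 = from-yes (all? λ x → (res x 1F + res x 2F + res x 0F) ≟ℕ 9) x
res-period x 1 = from-yes (all? λ x → (res x 2F + res x 0F + res x 1F) ≟ℕ 9) x
res-period x 2 = from-yes (all? λ x → (res x 0F + res x 1F + res x 2F) ≟ℕ 9) x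
res-period x (suc (suc (suc t))) = res-period x t

-- symSum h k is the sum of h |t| over −k ≤ t ≤ k.
symSum : (ℕ → ℕ) → ℕ → ℕ
symSum h zero    = h 0
symSum h (suc k) = symSum h k + 2 * h (suc k)

-- Going from `k` to `suc k` adds the two ends of the range, both at distance `suc k` from the new
-- centre; the terms in between shift by one together with the centre.
∑-∣-∣ : (h : ℕ → ℕ) → ∀ k → ∑ {suc (k + k)} (λ v → h ∣ toℕ v - k ∣) ≡ symSum h k
∑-∣-∣ h zero    = +-identityʳ (h 0)
∑-∣-∣ h (suc k) rewrite +-suc k k = begin
  h (suc k) + ∑ {suc (suc (k + k))} (λ v → h ∣ toℕ v - k ∣)
    ≡⟨ cong (h (suc k) +_) (∑-last {suc (k + k)} (λ v → h ∣ v - k ∣)) ⟩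
  h (suc k) + (∑ {suc (k + k)} (λ v → h ∣ toℕ v - k ∣) + h ∣ suc (k + k) - k ∣)
    ≡⟨ cong₂ (λ s t → h (suc k) + (s + h t)) (∑-∣-∣ h k) last-distance ⟩
  h (suc k) + (symSum h k + h (suc k))
    ≡⟨ regroup (h (suc k)) (symSum h k) ⟩
  symSum h k + 2 * h (suc k) ∎
  where
  open ≡-Reasoning
  regroup : ∀ a b → a + (b + a) ≡ b + 2 * a
  regroup = solve-∀
  last-distance : ∣ suc (k + k) - k ∣ ≡ suc k
  last-distance = trans (cong ∣_- k ∣ (≡.sym (+-suc k k))) (trans (∣-∣-comm (k + suc k) k) (∣m-m+n∣≡n k (suc k)))

∑-arithmetic : ∀ k → ∑ {suc (k + k)} (λ v → 15 + 7 * toℕ v) ≡ suc (k + k) * (15 + 7 * k)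
∑-arithmetic zero    = refl
∑-arithmetic (suc k) rewrite +-suc k k = begin
  ∑ {3 + (k + k)} (g ∘ toℕ)
    ≡⟨ ∑-last {2 + (k + k)} g ⟩
  ∑ {2 + (k + k)} (g ∘ toℕ) + g (2 + (k + k))
    ≡⟨ cong (_+ g (2 + (k + k))) (∑-last {suc (k + k)} g) ⟩
  ∑ {suc (k + k)} (g ∘ toℕ) + g (suc (k + k)) + g (2 + (k + k))
    ≡⟨ cong (λ s → s + g (suc (k + k)) + g (2 + (k + k))) (∑-arithmetic k) ⟩
  suc (k + k) * (15 + 7 * k) + g (suc (k + k)) + g (2 + (k + k))
    ≡⟨ step k ⟩
  (3 + (k + k)) * (15 + 7 * suc k) ∎
  where
  open ≡-Reasoning
  g : ℕ → ℕ
  g v = 15 + 7 * v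
  step : ∀ k → suc (k + k) * (15 + 7 * k) + (15 + 7 * suc (k + k)) + (15 + 7 * (2 + (k + k))) ≡ (3 + (k + k)) * (15 + 7 * suc k)
  step = solve-∀

-- Three consecutive distances meet all three phases and contribute 9 on either side of the centre,
-- hence 18 per period whatever the row. Differences between row sums therefore depend only on `k`
-- mod 3.
symSum-period : ∀ x q r → symSum (res x ∘ phase) (q * 3 + r) ≡ q * 18 + symSum (res x ∘ phase) r
symSum-period x zero    r = refl
symSum-period x (suc q) r = begin
  symSum h t + 2 * h (1 + t) + 2 * h (2 + t) + 2 * h t
    ≡⟨ regroup (symSum h t) (h (1 + t)) (h (2 + t)) (h t) ⟩
  symSum h t + 2 * (h (1 + t) + h (2 + t) + h t)
    ≡⟨ cong₂ (λ s u → s + 2 * u) (symSum-period x q r) (res-period x t) ⟩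
  q * 18 + symSum h r + 18
    ≡⟨ +-comm (q * 18 + symSum h r) 18 ⟩
  18 + (q * 18 + symSum h r)
    ≡⟨ +-assoc 18 (q * 18) _ ⟨
  suc q * 18 + symSum h r ∎
  where
  open ≡-Reasoning
  h = res x ∘ phase
  t = q * 3 + r
  regroup : ∀ s a b c → s + 2 * a + 2 * b + 2 * c ≡ s + 2 * (a + b + c)
  regroup = solve-∀

-- The 7 × m array of labels.

module Rectangle (k : ℕ) where

  m : ℕ
  m = suc k + k

  Column : Set
  Column = Fin (suc k) ⊎ Fin k

  -- The columns are divided by the parity of `up`. Within each part, when `up` grows by 2 both
  -- descending rows drop by 1, which keeps the sum at 3k. `down₁` takes the values 0, ..., k on the
  -- first part and k + 1, ..., 2k on the second; `down₂` takes k, ..., 2k and then 0, ..., k - 1.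
  up down₁ down₂ : Column → ℕ
  up    (inj₁ i) = 2 * toℕ i
  up    (inj₂ i) = suc (2 * toℕ i)
  down₁ (inj₁ i) = k ∸ toℕ i
  down₁ (inj₂ i) = k + (k ∸ toℕ i)
  down₂ (inj₁ i) = k + (k ∸ toℕ i)
  down₂ (inj₂ i) = k ∸ suc (toℕ i)

  i≤k : (i : Fin (suc k)) → toℕ i ≤ k
  i≤k = toℕ≤pred[n]

  up<m : ∀ c → up c < m
  up<m (inj₁ i) rewrite +-identityʳ (toℕ i) = s≤s (+-mono-≤ (i≤k i) (i≤k i))
  up<m (inj₂ i) rewrite +-identityʳ (toℕ i) = s≤s (+-mono-≤ (toℕ<n i) (<⇒≤ (toℕ<n i)))

  down₁<m : ∀ c → down₁ c < m
  down₁<m (inj₁ i) = s≤s (≤-trans (m∸n≤m k (toℕ i)) (m≤m+n k k))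
  down₁<m (inj₂ i) = s≤s (+-monoʳ-≤ k (m∸n≤m k (toℕ i)))

  down₂<m : ∀ c → down₂ c < m
  down₂<m (inj₁ i) = s≤s (+-monoʳ-≤ k (m∸n≤m k (toℕ i)))
  down₂<m (inj₂ i) = s≤s (≤-trans (m∸n≤m k (suc (toℕ i))) (m≤m+n k k))

  up-injective : Injective _≡_ _≡_ up
  up-injective {inj₁ i} {inj₁ j} eq = cong inj₁ (toℕ-injective (*-cancelˡ-≡ _ _ 2 eq))
  up-injective {inj₁ i} {inj₂ j} eq = contradiction eq (even≢odd (toℕ i) (toℕ j))
  up-injective {inj₂ i} {inj₁ j} eq = contradiction (≡.sym eq) (even≢odd (toℕ j) (toℕ i))
  up-injective {inj₂ i} {inj₂ j} eq = cong inj₂ (toℕ-injective (*-cancelˡ-≡ _ _ 2 (suc-injective eq)))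

  down₁-left<right : ∀ i j → down₁ (inj₁ i) < down₁ (inj₂ j)
  down₁-left<right i j = ≤-<-trans (m∸n≤m k (toℕ i)) (m<m+n k (m<n⇒0<n∸m (toℕ<n j)))

  down₂-right<left : ∀ i j → down₂ (inj₂ j) < down₂ (inj₁ i)
  down₂-right<left i j = <-≤-trans (∸-monoʳ-< z<s (toℕ<n j)) (m≤m+n k _)

  down₁-injective : Injective _≡_ _≡_ down₁
  down₁-injective {inj₁ i} {inj₁ j} eq = cong inj₁ (toℕ-injective (∸-cancelˡ-≡ (i≤k i) (i≤k j) eq))
  down₁-injective {inj₁ i} {inj₂ j} eq = contradiction eq (<⇒≢ (down₁-left<right i j))
  down₁-injective {inj₂ i} {inj₁ j} eq = contradiction (≡.sym eq) (<⇒≢ (down₁-left<right j i))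
  down₁-injective {inj₂ i} {inj₂ j} eq = cong inj₂ (toℕ-injective
    (∸-cancelˡ-≡ (<⇒≤ (toℕ<n i)) (<⇒≤ (toℕ<n j)) (+-cancelˡ-≡ k _ _ eq)))

  down₂-injective : Injective _≡_ _≡_ down₂
  down₂-injective {inj₁ i} {inj₁ j} eq = cong inj₁ (toℕ-injective
    (∸-cancelˡ-≡ (i≤k i) (i≤k j) (+-cancelˡ-≡ k _ _ eq)))
  down₂-injective {inj₁ i} {inj₂ j} eq = contradiction (≡.sym eq) (<⇒≢ (down₂-right<left i j))
  down₂-injective {inj₂ i} {inj₁ j} eq = contradiction eq (<⇒≢ (down₂-right<left j i))
  down₂-injective {inj₂ i} {inj₂ j} eq = cong inj₂ (toℕ-injective
    (suc-injective (∸-cancelˡ-≡ (toℕ<n i) (toℕ<n j) eq)))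

  up+down₁+down₂ : ∀ c → up c + down₁ c + down₂ c ≡ 3 * k
  up+down₁+down₂ (inj₁ i) = begin
    2 * toℕ i + (k ∸ toℕ i) + (k + (k ∸ toℕ i))
      ≡⟨ regroup (toℕ i) (k ∸ toℕ i) k ⟩
    k + 2 * (toℕ i + (k ∸ toℕ i))
      ≡⟨ cong (λ s → k + 2 * s) (m+[n∸m]≡n (i≤k i)) ⟩
    3 * k ∎
    where
    open ≡-Reasoning
    regroup : ∀ i d k → 2 * i + d + (k + d) ≡ k + 2 * (i + d)
    regroup = solve-∀
  up+down₁+down₂ (inj₂ i) = begin
    suc (2 * toℕ i) + (k + (k ∸ toℕ i)) + (k ∸ suc (toℕ i))
      -- As `toℕ i < k`, the difference in `down₁` is the successor of the one in `down₂`, so a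
      -- single variable expresses both.
      ≡⟨ cong (λ d → suc (2 * toℕ i) + (k + d) + (k ∸ suc (toℕ i))) (+-∸-assoc 1 (toℕ<n i)) ⟩
    suc (2 * toℕ i) + (k + suc (k ∸ suc (toℕ i))) + (k ∸ suc (toℕ i))
      ≡⟨ regroup (toℕ i) (k ∸ suc (toℕ i)) k ⟩
    k + 2 * (suc (toℕ i) + (k ∸ suc (toℕ i)))
      ≡⟨ cong (λ s → k + 2 * s) (m+[n∸m]≡n (toℕ<n i)) ⟩
    3 * k ∎
    where
    open ≡-Reasoning
    regroup : ∀ i e k → suc (2 * i) + (k + suc e) + e ≡ k + 2 * (suc i + e)
    regroup = solve-∀

  Up Down₁ Down₂ : Column → Fin m
  Up    c = fromℕ< (up<m c)
  Down₁ c = fromℕ< (down₁<m c)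
  Down₂ c = fromℕ< (down₂<m c)

  fromℕ<-injective′ : {f : Column → ℕ} (f<m : ∀ c → f c < m) → Injective _≡_ _≡_ f →
                      Injective _≡_ _≡_ (λ c → fromℕ< (f<m c))
  fromℕ<-injective′ f<m inj eq = inj (fromℕ<-injective _ _ (f<m _) (f<m _) eq)

  opposite-injective : Injective _≡_ _≡_ (opposite {m})
  opposite-injective {i} {j} eq =
    trans (≡.sym (opposite-involutive i)) (trans (cong opposite eq) (opposite-involutive j))

  row : Fin 7 → Column → Fin m
  row 0F = Up
  row 1F = Down₁
  row 2F = Down₁
  row 3F = opposite ∘ Down₁
  row 4F = Down₂
  row 5F = Down₂
  row 6F = opposite ∘ Down₂

  row-injective : ∀ x → Injective _≡_ _≡_ (row x)
  row-injective 0F = fromℕ<-injective′ up<m up-injective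
  row-injective 1F = fromℕ<-injective′ down₁<m down₁-injective
  row-injective 2F = row-injective 1F
  row-injective 3F = row-injective 1F ∘ opposite-injective
  row-injective 4F = fromℕ<-injective′ down₂<m down₂-injective
  row-injective 5F = row-injective 4F
  row-injective 6F = row-injective 4F ∘ opposite-injective

  phaseOf : Fin m → Fin 3
  phaseOf v = phase ∣ toℕ v - k ∣

  code : Fin 7 → Fin m → Fin (m * 7)
  code x v = combine v (residue x (phaseOf v))

  -- The quotient of the code recovers `v` and with it the phase; at a fixed phase the residue
  -- recovers the row.
  code-injective : ∀ x y u v → code x u ≡ code y v → x ≡ y × u ≡ v
  code-injective x y u v eq with refl , res≡ ← combine-injective u _ v _ eq =
    residue-injective (phaseOf u) x y res≡ , refl

  entry : Fin 7 → Fin m → ℕ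
  entry x j = 15 + toℕ (code x (row x (splitAt (suc k) j)))

  entry-injective : ∀ {x y i j} → entry x i ≡ entry y j → x ≡ y × i ≡ j
  entry-injective {x} {y} {i} {j} eq
    with refl , rows≡ ← code-injective x y (row x (splitAt (suc k) i)) (row y (splitAt (suc k) j)) (toℕ-injective (+-cancelˡ-≡ 15 _ _ eq))
    = refl , splitAt-injective (row-injective x rows≡)
    where
    splitAt-injective : ∀ {i j} → splitAt (suc k) i ≡ splitAt (suc k) j → i ≡ j
    splitAt-injective {i} {j} eq = trans (≡.sym (join-splitAt (suc k) k i))
      (trans (cong (join (suc k) k) eq) (join-splitAt (suc k) k j))

  entry≤ : ∀ x j → entry x j ≤ 14 + 7 * m
  entry≤ x j = subst (λ s → entry x j ≤ 14 + s) (*-comm m 7)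
    (+-monoʳ-≤ 14 (toℕ<n (code x (row x (splitAt (suc k) j)))))

  toℕ-code : ∀ x v → toℕ (code x v) ≡ 7 * toℕ v + res x (phaseOf v)
  toℕ-code x v = toℕ-combine v (residue x (phaseOf v))

  opposite-sum : (v : Fin m) → toℕ v + toℕ (opposite v) ≡ k + k
  opposite-sum v = trans (cong (toℕ v +_) (opposite-prop v)) (m+[n∸m]≡n (toℕ≤pred[n] v))

  -- The reflection v ↦ 2k - v preserves the distance to the centre. Hence in every column the three
  -- rows of a triple are read at the same phase, where their residues sum to 9.
  phaseOf-opposite : (v : Fin m) → phaseOf (opposite v) ≡ phaseOf v
  phaseOf-opposite v = cong phase (begin
    ∣ v′ - k ∣              ≡⟨ ∣-∣-comm v′ k ⟩
    ∣ k - v′ ∣              ≡⟨ ∣m+n-m+o∣≡∣n-o∣ k k v′ ⟨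
    ∣ k + k - k + v′ ∣      ≡⟨ cong₂ ∣_-_∣ (trans (≡.sym (opposite-sum v)) (+-comm (toℕ v) v′)) (+-comm k v′) ⟩
    ∣ v′ + toℕ v - v′ + k ∣ ≡⟨ ∣m+n-m+o∣≡∣n-o∣ v′ (toℕ v) k ⟩
    ∣ toℕ v - k ∣           ∎)
    where
    open ≡-Reasoning
    v′ = toℕ (opposite v)

  toℕ-code-opposite : ∀ x v → toℕ (code x (opposite v)) ≡ 7 * toℕ (opposite v) + res x (phaseOf v)
  toℕ-code-opposite x v = trans (toℕ-code x (opposite v))
    (cong (λ p → 7 * toℕ (opposite v) + res x p) (phaseOf-opposite v))

  columnSum : ∀ c → ∑ (λ x → 15 + toℕ (code x (row x c))) ≡ 126 + 49 * k
  columnSum c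
    rewrite toℕ-code 0F (Up c) | res-row₀ (phaseOf (Up c))
          | toℕ-code 1F (Down₁ c) | toℕ-code 2F (Down₁ c) | toℕ-code-opposite 3F (Down₁ c)
          | toℕ-code 4F (Down₂ c) | toℕ-code 5F (Down₂ c) | toℕ-code-opposite 6F (Down₂ c)
    = begin
    _ ≡⟨ regroup (toℕ (Up c)) b b′ d d′ (res 1F p) (res 2F p) (res 3F p) (res 4F q) (res 5F q) (res 6F q) ⟩
    -- 108 = 7 · 15 + 3 collects the offsets and the constant residue of row 0. The quotients are
    -- grouped into one sum 3k and two complementary pairs of sum 2k each.
    108 + 7 * ((toℕ (Up c) + b + d) + (b + b′) + (d + d′)) + (res 1F p + res 2F p + res 3F p) + (res 4F q + res 5F q + res 6F q)
      ≡⟨ total threeRows (opposite-sum (Down₁ c)) (opposite-sum (Down₂ c)) (res-sum₁ p) (res-sum₂ q) ⟩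
    126 + 49 * k ∎
    where
    open ≡-Reasoning
    b = toℕ (Down₁ c)
    d = toℕ (Down₂ c)
    b′ = toℕ (opposite (Down₁ c))
    d′ = toℕ (opposite (Down₂ c))
    p = phaseOf (Down₁ c)
    q = phaseOf (Down₂ c)
    threeRows : toℕ (Up c) + b + d ≡ 3 * k
    threeRows = trans (cong₂ _+_ (cong₂ _+_ (toℕ-fromℕ< (up<m c)) (toℕ-fromℕ< (down₁<m c))) (toℕ-fromℕ< (down₂<m c)))
      (up+down₁+down₂ c)
    regroup : ∀ a b b′ d d′ x y z u v w →
      15 + (7 * a + 3) + (15 + (7 * b + x) + (15 + (7 * b + y) + (15 + (7 * b′ + z)
        + (15 + (7 * d + u) + (15 + (7 * d + v) + (15 + (7 * d′ + w) + 0))))))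
      ≡ 108 + 7 * ((a + b + d) + (b + b′) + (d + d′)) + (x + y + z) + (u + v + w)
    regroup = solve-∀
    evaluate : ∀ k → 108 + 7 * (3 * k + (k + k) + (k + k)) + 9 + 9 ≡ 126 + 49 * k
    evaluate = solve-∀
    total : ∀ {s t u v w} → s ≡ 3 * k → t ≡ k + k → u ≡ k + k → v ≡ 9 → w ≡ 9 →
            108 + 7 * (s + t + u) + v + w ≡ 126 + 49 * k
    total refl refl refl refl refl = evaluate k

  -- A row meets every quotient exactly once. This leaves an arithmetic progression of `m` terms
  -- with mean 15 + 7k, plus residues that depend only on the distance to the centre.
  rowSum : ∀ x → ∑ (entry x) ≡ m * (15 + 7 * k) + symSum (res x ∘ phase) k
  rowSum x = begin
    ∑ (entry x)
      -- The self-map `row x ∘ splitAt (suc k)` of `Fin m` inherits its injectivity from `entry`.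
      ≡⟨ ∑-injective (row x ∘ splitAt (suc k)) (proj₂ ∘ entry-injective {x} {x} ∘ cong (λ v → 15 + toℕ (code x v))) (λ v → 15 + toℕ (code x v)) ⟩
    ∑ (λ v → 15 + toℕ (code x v))
      ≡⟨ sum-cong-≗ (λ v → trans (cong (15 +_) (toℕ-code x v)) (≡.sym (+-assoc 15 (7 * toℕ v) _))) ⟩
    ∑ (λ v → 15 + 7 * toℕ v + res x (phaseOf v))
      ≡⟨ ∑-distrib-+ {m} (λ v → 15 + 7 * toℕ v) (res x ∘ phaseOf) ⟩
    ∑ {m} (λ v → 15 + 7 * toℕ v) + ∑ {m} (res x ∘ phaseOf)
      ≡⟨ cong₂ _+_ (∑-arithmetic k) (∑-∣-∣ (res x ∘ phase) k) ⟩
    m * (15 + 7 * k) + symSum (res x ∘ phase) k ∎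
    where open ≡-Reasoning

-- From a core labeling to a labeling of the join.

coreSum : Graph 7 → Vec (Vec ℕ 7) 7 → Fin 7 → ℕ
coreSum G w x = ∑ (λ y → if adj G x y then (w ‼ x) ‼ y else 0)

-- The part of a core vertex sum that depends on the vertex, for k ≡ r (mod 3).
base : Graph 7 → Vec (Vec ℕ 7) 7 → Fin 3 → Fin 7 → ℕ
base G w r x = coreSum G w x + symSum (res x ∘ phase) (toℕ r)

baseColours : Graph 7 → Vec (Vec ℕ 7) 7 → Fin 3 → List ℕ
baseColours G w r = deduplicate _≟ℕ_ (map (base G w r) (allFin 7))

-- These are finite conditions on a 7 × 7 matrix, decided by evaluation. Properness is asked of
-- `base` because all other contributions to a core vertex sum are common to the core. The bounds in
-- `base-range` keep core sums apart from the column sum.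
record Admissible (G : Graph 7) (r : Fin 3) (w : Vec (Vec ℕ 7) 7) : Set where
  field
    symmetric  : ∀ x y → (w ‼ x) ‼ y ≡ (w ‼ y) ‼ x
    inRange    : ∀ x y → adj G x y ≡ true → 1 ≤ (w ‼ x) ‼ y × (w ‼ x) ‼ y ≤ 14
    injective  : ∀ x y → toℕ x < toℕ y × adj G x y ≡ true → ∀ x′ y′ → toℕ x′ < toℕ y′ × adj G x′ y′ ≡ true →
                 (w ‼ x) ‼ y ≡ (w ‼ x′) ‼ y′ → x ≡ x′ × y ≡ y′
    proper     : ∀ x y → adj G x y ≡ true → base G w r x ≢ base G w r y
    base-range : ∀ x → 4 ≤ base G w r x × base G w r x ≤ 78

admissible? : ∀ G r w → Dec (Admissible G r w)
admissible? G r w = map′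
  (λ (a , b , c , d , e) → record { symmetric = a ; inRange = b ; injective = c ; proper = d ; base-range = e })
  (λ A → let open Admissible A in symmetric , inRange , injective , proper , base-range)
  (     (all? λ x → all? λ y → (w ‼ x) ‼ y ≟ℕ (w ‼ y) ‼ x)
  ×-dec (all? λ x → all? λ y → adj G x y ≟B true →-dec (1 ≤? (w ‼ x) ‼ y ×-dec (w ‼ x) ‼ y ≤? 14))
  ×-dec (all? λ x → all? λ y → edge? x y →-dec (all? λ x′ → all? λ y′ → edge? x′ y′ →-dec
          ((w ‼ x) ‼ y ≟ℕ (w ‼ x′) ‼ y′ →-dec (x ≟F x′ ×-dec y ≟F y′))))
  ×-dec (all? λ x → all? λ y → adj G x y ≟B true →-dec ¬? (base G w r x ≟ℕ base G w r y))
  ×-dec (all? λ x → 4 ≤? base G w r x ×-dec base G w r x ≤? 78))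
  where
  edge? : ∀ x y → Dec (toℕ x < toℕ y × adj G x y ≡ true)
  edge? x y = toℕ x <? toℕ y ×-dec adj G x y ≟B true

-- The column sum 126 + 49k lies above all row sums for k ≤ 2 and below them for k ≥ 3.
rowSum≢columnSum : ∀ q (r : Fin 3) → let k = q * 3 + toℕ r in 1 ≤ k → ∀ b → 4 ≤ b → b ≤ 78 →
                   b + (suc (k + k) * (15 + 7 * k) + q * 18) ≢ 126 + 49 * k
-- The common part of the row sums is 3 · 22 = 66 for k = 1 and 5 · 29 = 145 for k = 2. The bound 78
-- is sharp at k = 2, where 78 + 145 = 223 and the column sum is 224.
rowSum≢columnSum zero 1F _ b _ b≤78 = <⇒≢ (≤-<-trans (+-monoˡ-≤ 66 b≤78) (from-yes (144 <? 175)))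
rowSum≢columnSum zero 2F _ b _ b≤78 = <⇒≢ (≤-<-trans (+-monoˡ-≤ 145 b≤78) (from-yes (223 <? 224)))
rowSum≢columnSum (suc q) r _ b 4≤b _ eq = <⇒≢ (begin-strict
  126 + 49 * k                                          <⟨ s≤s (m≤m+n _ _) ⟩
  -- The bound 4 is sharp at k = 3, where the two sides are 274 and 273; beyond that the excess is a
  -- polynomial in `l` and `q` with nonnegative coefficients.
  suc (126 + 49 * k + (72 * l + 14 * (l * l) + 18 * q)) ≡⟨ expand l q ⟨
  4 + (suc (k + k) * (15 + 7 * k) + suc q * 18)         ≤⟨ +-monoˡ-≤ _ 4≤b ⟩
  b + (suc (k + k) * (15 + 7 * k) + suc q * 18)         ∎) (≡.sym eq)
  where
  open ≤-Reasoning
  l = q * 3 + toℕ r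
  k = 3 + l
  expand : ∀ l q → 4 + (suc (3 + l + (3 + l)) * (15 + 7 * (3 + l)) + suc q * 18)
                 ≡ suc (126 + 49 * (3 + l) + (72 * l + 14 * (l * l) + 18 * q))
  expand = solve-∀

module _ (G : Graph 7) (size≡14 : size G ≡ 14) (q : ℕ) (r : Fin 3) (1≤k : 1 ≤ q * 3 + toℕ r)
         (w : Vec (Vec ℕ 7) 7) (A : Admissible G r w) where

  open Admissible A
  open Rectangle (q * 3 + toℕ r)

  private
    k : ℕ
    k = q * 3 + toℕ r

    J : Graph (7 + m)
    J = G ⋁ O m

    weight : Fin (7 + m) → Fin (7 + m) → ℕ
    weight = joinWeight G m (λ x y → (w ‼ x) ‼ y) entry symmetric

    shift : ℕ
    shift = m * (15 + 7 * k) + q * 18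

  labeling : Labeling J
  labeling = joinLabel G m (λ x y → (w ‼ x) ‼ y) entry symmetric

  -- The full periods of the residues add the same `q * 18` to every row, so `q` enters only through
  -- the common `shift` and the colouring of the core is governed by `base`.
  vsum-core : ∀ x → vsum J labeling (x ↑ˡ m) ≡ base G w r x + shift
  vsum-core x = begin
    vsum J labeling (x ↑ˡ m)
      ≡⟨ vsum-left G m _ entry symmetric x ⟩
    coreSum G w x + ∑ (entry x)
      ≡⟨ cong (coreSum G w x +_) (trans (rowSum x) (cong (m * (15 + 7 * k) +_) (symSum-period x q (toℕ r)))) ⟩
    coreSum G w x + (m * (15 + 7 * k) + (q * 18 + symSum (res x ∘ phase) (toℕ r)))
      ≡⟨ regroup (coreSum G w x) (m * (15 + 7 * k)) (q * 18) _ ⟩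
    base G w r x + shift ∎
    where
    open ≡-Reasoning
    regroup : ∀ a b c d → a + (b + (c + d)) ≡ a + d + (b + c)
    regroup = solve-∀

  vsum-outer : ∀ j → vsum J labeling (7 ↑ʳ j) ≡ 126 + 49 * k
  vsum-outer j = trans (vsum-right G m _ entry symmetric j) (columnSum (splitAt (suc k) j))

  core≢outer : ∀ x → base G w r x + shift ≢ 126 + 49 * k
  core≢outer x = rowSum≢columnSum q r 1≤k (base G w r x) (proj₁ (base-range x)) (proj₂ (base-range x))

  private
    weight-core : ∀ x y → weight (x ↑ˡ m) (y ↑ˡ m) ≡ (w ‼ x) ‼ y
    weight-core = weight-left-left G m _ entry symmetric

    weight-cross : ∀ x j → weight (x ↑ˡ m) (7 ↑ʳ j) ≡ entry x j
    weight-cross = weight-left-right G m _ entry symmetric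

    IsEdge : Fin (7 + m) → Fin (7 + m) → Set
    IsEdge i j = toℕ i < toℕ j × adj J i j ≡ true

    core-edge : ∀ {x y} → IsEdge (x ↑ˡ m) (y ↑ˡ m) → toℕ x < toℕ y × adj G x y ≡ true
    core-edge {x} {y} (lt , xy) =
      ≡.subst₂ _<_ (toℕ-↑ˡ x m) (toℕ-↑ˡ y m) lt , trans (≡.sym (adj-left-left G m x y)) xy

  data EdgeView : Fin (7 + m) → Fin (7 + m) → Set where
    core  : (x y : Fin 7) → toℕ x < toℕ y × adj G x y ≡ true → EdgeView (x ↑ˡ m) (y ↑ˡ m)
    cross : (x : Fin 7) (j : Fin m) → EdgeView (x ↑ˡ m) (7 ↑ʳ j)

  edgeView : ∀ i j → IsEdge i j → EdgeView i j
  edgeView i j e with side 7 i | side 7 j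
  ... | left x  | left y  = core x y (core-edge e)
  ... | left x  | right j = cross x j
  ... | right i | left y  = contradiction (proj₁ e) (<-asym (left<right G m y i))
  ... | right i | right j = contradiction (trans (≡.sym (proj₂ e)) (adj-right-right G m i j)) λ ()

  -- Core labels are at most 14 and cross labels at least 15, so only edges of the same kind can
  -- share a label; there `injective` and `entry-injective` apply.
  weight-injective : ∀ {i j i′ j′} → EdgeView i j → EdgeView i′ j′ →
                     weight i j ≡ weight i′ j′ → (i , j) ≡ (i′ , j′)
  weight-injective (core x y e) (core x′ y′ e′) eq
    with refl , refl ← injective x y e x′ y′ e′
           (trans (≡.sym (weight-core x y)) (trans eq (weight-core x′ y′))) = refl
  weight-injective (core x y e) (cross x′ j′) eq = contradiction
    (trans (≡.sym (weight-core x y)) (trans eq (weight-cross x′ j′)))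
    (<⇒≢ (≤-<-trans (proj₂ (inRange x y (proj₂ e))) (m≤m+n 15 _)))
  weight-injective (cross x j) (core x′ y′ e′) eq = contradiction
    (trans (≡.sym (weight-core x′ y′)) (trans (≡.sym eq) (weight-cross x j)))
    (<⇒≢ (≤-<-trans (proj₂ (inRange x′ y′ (proj₂ e′))) (m≤m+n 15 _)))
  weight-injective (cross x j) (cross x′ j′) eq
    with refl , refl ← entry-injective {x} {x′} {j} {j′}
           (trans (≡.sym (weight-cross x j)) (trans eq (weight-cross x′ j′))) = refl

  size-J : size J ≡ 14 + 7 * m
  size-J = trans (size-join G m) (cong (_+ 7 * m) size≡14)

  weight-range : ∀ {i j} → EdgeView i j → 1 ≤ weight i j × weight i j ≤ 14 + 7 * m
  weight-range (core x y (_ , xy)) = subst (λ l → 1 ≤ l × l ≤ 14 + 7 * m) (≡.sym (weight-core x y))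
    (proj₁ (inRange x y xy) , ≤-trans (proj₂ (inRange x y xy)) (m≤m+n 14 _))
  weight-range (cross x j) = subst (λ l → 1 ≤ l × l ≤ 14 + 7 * m) (≡.sym (weight-cross x j))
    (s≤s z≤n , entry≤ x j)

  vsum-proper : ∀ {i j} → EdgeView i j → vsum J labeling i ≢ vsum J labeling j
  vsum-proper (core x y (_ , xy)) eq = proper x y xy
    (+-cancelʳ-≡ shift _ _ (trans (≡.sym (vsum-core x)) (trans eq (vsum-core y))))
  vsum-proper (cross x j) eq = core≢outer x (trans (≡.sym (vsum-core x)) (trans eq (vsum-outer j)))

  labeling-antimagic : IsLocalAntimagic J labeling
  labeling-antimagic =
    ( (λ {e} {e′} eq → lookup-injective (edges-Unique J) (weight-injective (view e) (view e′) eq))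
    , λ e → proj₁ (weight-range (view e)) , ≤-trans (proj₂ (weight-range (view e))) (≤-reflexive (≡.sym size-J))) , λ e → vsum-proper (view e)
    where
    view : ∀ e → EdgeView (proj₁ (lookup (edges J) e)) (proj₂ (lookup (edges J) e))
    view e = edgeView _ _ (edge-lookup J e)

  labeling-colours : numColors J labeling ≤ suc (length (baseColours G w r))
  labeling-colours = subst (numColors J labeling ≤_) (cong suc (length-map (_+ shift) (baseColours G w r)))
    (numColors-≤ J labeling (126 + 49 * k ∷ map (_+ shift) (baseColours G w r)) (λ u → inPalette (side 7 u)))
    where
    inPalette : ∀ {u} → Side {7} {m} u → vsum J labeling u ∈ 126 + 49 * k ∷ map (_+ shift) (baseColours G w r)
    inPalette (right j) = here (vsum-outer j)
    inPalette (left x)  = there (subst (_∈ map (_+ shift) (baseColours G w r)) (≡.sym (vsum-core x))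
      (∈-map⁺ (_+ shift) (∈-deduplicate⁺ _≟ℕ_ (∈-map⁺ (base G w r) (∈-allFin x)))))

  -- The palette gives only an upper bound on the colours of `labeling`; the lower bound, applied to
  -- this same labeling, makes the count exact.
  chiLa-join : (∀ f → IsLocalAntimagic (G ⋁ O m) f → suc (length (baseColours G w r)) ≤ numColors (G ⋁ O m) f) →
               ChiLa≡ (G ⋁ O m) (suc (length (baseColours G w r)))
  chiLa-join lower =
    (labeling , labeling-antimagic , ≤-antisym labeling-colours (lower labeling labeling-antimagic)) , lower

-- Explicit core labelings and their verification by evaluation.

-- Found by local search for each k mod 3; the entries 0 mark non-edges.
weights₁ : Fin 3 → Vec (Vec ℕ 7) 7
weights₁ 0F =
  ( 0 ∷  3 ∷  9 ∷  0 ∷  0 ∷  1 ∷ 12 ∷ []) ∷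
  ( 3 ∷  0 ∷ 13 ∷  7 ∷  0 ∷  0 ∷  4 ∷ []) ∷
  ( 9 ∷ 13 ∷  0 ∷  2 ∷  6 ∷  0 ∷  0 ∷ []) ∷
  ( 0 ∷  7 ∷  2 ∷  0 ∷  5 ∷ 14 ∷  0 ∷ []) ∷
  ( 0 ∷  0 ∷  6 ∷  5 ∷  0 ∷  8 ∷ 10 ∷ []) ∷
  ( 1 ∷  0 ∷  0 ∷ 14 ∷  8 ∷  0 ∷ 11 ∷ []) ∷
  (12 ∷  4 ∷  0 ∷  0 ∷ 10 ∷ 11 ∷  0 ∷ []) ∷ []
weights₁ 1F =
  ( 0 ∷  1 ∷  9 ∷  0 ∷  0 ∷ 10 ∷  5 ∷ []) ∷
  ( 1 ∷  0 ∷ 13 ∷  4 ∷  0 ∷  0 ∷ 11 ∷ []) ∷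
  ( 9 ∷ 13 ∷  0 ∷  8 ∷  7 ∷  0 ∷  0 ∷ []) ∷
  ( 0 ∷  4 ∷  8 ∷  0 ∷ 12 ∷  2 ∷  0 ∷ []) ∷
  ( 0 ∷  0 ∷  7 ∷ 12 ∷  0 ∷ 14 ∷  6 ∷ []) ∷
  (10 ∷  0 ∷  0 ∷  2 ∷ 14 ∷  0 ∷  3 ∷ []) ∷
  ( 5 ∷ 11 ∷  0 ∷  0 ∷  6 ∷  3 ∷  0 ∷ []) ∷ []
weights₁ 2F =
  ( 0 ∷ 12 ∷  3 ∷  0 ∷  0 ∷ 13 ∷  7 ∷ []) ∷
  (12 ∷  0 ∷ 14 ∷  2 ∷  0 ∷  0 ∷  4 ∷ []) ∷
  ( 3 ∷ 14 ∷  0 ∷  9 ∷  8 ∷  0 ∷  0 ∷ []) ∷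
  ( 0 ∷  2 ∷  9 ∷  0 ∷ 11 ∷ 10 ∷  0 ∷ []) ∷
  ( 0 ∷  0 ∷  8 ∷ 11 ∷  0 ∷  6 ∷  5 ∷ []) ∷
  (13 ∷  0 ∷  0 ∷ 10 ∷  6 ∷  0 ∷  1 ∷ []) ∷
  ( 7 ∷  4 ∷  0 ∷  0 ∷  5 ∷  1 ∷  0 ∷ []) ∷ []

weights₂ : Fin 3 → Vec (Vec ℕ 7) 7
weights₂ 0F =
  ( 0 ∷  0 ∷  0 ∷ 14 ∷  7 ∷ 10 ∷  1 ∷ []) ∷
  ( 0 ∷  0 ∷  0 ∷  6 ∷ 11 ∷  2 ∷ 12 ∷ []) ∷
  ( 0 ∷  0 ∷  0 ∷  9 ∷  5 ∷ 13 ∷  3 ∷ []) ∷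
  (14 ∷  6 ∷  9 ∷  0 ∷  0 ∷  4 ∷  0 ∷ []) ∷
  ( 7 ∷ 11 ∷  5 ∷  0 ∷  0 ∷  0 ∷  8 ∷ []) ∷
  (10 ∷  2 ∷ 13 ∷  4 ∷  0 ∷  0 ∷  0 ∷ []) ∷
  ( 1 ∷ 12 ∷  3 ∷  0 ∷  8 ∷  0 ∷  0 ∷ []) ∷ []
weights₂ 1F =
  ( 0 ∷  0 ∷  0 ∷  7 ∷ 10 ∷ 12 ∷  1 ∷ []) ∷
  ( 0 ∷  0 ∷  0 ∷ 13 ∷  2 ∷  4 ∷  6 ∷ []) ∷
  ( 0 ∷  0 ∷  0 ∷  8 ∷ 14 ∷  3 ∷  9 ∷ []) ∷
  ( 7 ∷ 13 ∷  8 ∷  0 ∷  0 ∷  5 ∷  0 ∷ []) ∷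
  (10 ∷  2 ∷ 14 ∷  0 ∷  0 ∷  0 ∷ 11 ∷ []) ∷
  (12 ∷  4 ∷  3 ∷  5 ∷  0 ∷  0 ∷  0 ∷ []) ∷
  ( 1 ∷  6 ∷  9 ∷  0 ∷ 11 ∷  0 ∷  0 ∷ []) ∷ []
weights₂ 2F =
  ( 0 ∷  0 ∷  0 ∷  4 ∷  8 ∷  6 ∷ 14 ∷ []) ∷
  ( 0 ∷  0 ∷  0 ∷ 10 ∷  2 ∷ 12 ∷  9 ∷ []) ∷
  ( 0 ∷  0 ∷  0 ∷ 11 ∷ 13 ∷  7 ∷  3 ∷ []) ∷
  ( 4 ∷ 10 ∷ 11 ∷  0 ∷  0 ∷  1 ∷  0 ∷ []) ∷
  ( 8 ∷  2 ∷ 13 ∷  0 ∷  0 ∷  0 ∷  5 ∷ []) ∷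
  ( 6 ∷ 12 ∷  7 ∷  1 ∷  0 ∷  0 ∷  0 ∷ []) ∷
  (14 ∷  9 ∷  3 ∷  0 ∷  5 ∷  0 ∷  0 ∷ []) ∷ []

admissible₁ : ∀ r → Admissible A₁ r (weights₁ r)
admissible₁ = from-yes (all? λ r → admissible? A₁ r (weights₁ r))

admissible₂ : ∀ r → Admissible A₂ r (weights₂ r)
admissible₂ = from-yes (all? λ r → admissible? A₂ r (weights₂ r))

colours₁ : ∀ r → length (baseColours A₁ (weights₁ r) r) ≡ 4
colours₁ = from-yes (all? λ r → length (baseColours A₁ (weights₁ r) r) ≟ℕ 4)

colours₂ : ∀ r → length (baseColours A₂ (weights₂ r) r) ≡ 3
colours₂ = from-yes (all? λ r → length (baseColours A₂ (weights₂ r) r) ≟ℕ 3)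

-- Lower bounds from cliques and diamonds in the core.

module _ (G : Graph 7) (m : ℕ) (f : Labeling (G ⋁ O (suc m))) (f-antimagic : IsLocalAntimagic (G ⋁ O (suc m)) f) where

  private
    J : Graph (7 + suc m)
    J = G ⋁ O (suc m)

    ι : Fin 7 → Fin (7 + suc m)
    ι x = x ↑ˡ suc m

    _#_ : Fin (7 + suc m) → Fin (7 + suc m) → Set
    i # j = vsum J f i ≢ vsum J f j

  core-# : ∀ x y → adj G x y ≡ true → ι x # ι y
  core-# x y xy = adjacent⇒vsum≢ J f f-antimagic (ι x) (ι y) (trans (adj-left-left G (suc m) x y) xy)

  apex-# : ∀ x → (7 ↑ʳ zero) # ι x
  apex-# x = adjacent⇒vsum≢ J f f-antimagic (7 ↑ʳ zero) (ι x) (adj-right-left G (suc m) zero x)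

  -- An outer vertex, here called the apex, is adjacent to the whole core and completes the triangle
  -- to a K₄.
  triangle⇒4≤ : ∀ x y z → adj G x y ≡ true → adj G x z ≡ true → adj G y z ≡ true → 4 ≤ numColors J f
  triangle⇒4≤ x y z xy xz yz = numColors-≥ J f ((7 ↑ʳ zero) ∷ ι x ∷ ι y ∷ ι z ∷ [])
    ( (apex-# x ∷ apex-# y ∷ apex-# z ∷ [])
    ∷ (core-# x y xy ∷ core-# x z xz ∷ [])
    ∷ (core-# y z yz ∷ [])
    ∷ [] ∷ [])

  -- The ends `x` and `t` are the one pair not separated by an assumed edge or by the apex, hence
  -- the extra hypothesis on their sums.
  diamond⇒5≤ : ∀ x y z t → adj G x y ≡ true → adj G x z ≡ true → adj G y z ≡ true → adj G y t ≡ true → adj G z t ≡ true →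
               ι x # ι t → 5 ≤ numColors J f
  diamond⇒5≤ x y z t xy xz yz yt zt x#t = numColors-≥ J f ((7 ↑ʳ zero) ∷ ι x ∷ ι y ∷ ι z ∷ ι t ∷ [])
    ( (apex-# x ∷ apex-# y ∷ apex-# z ∷ apex-# t ∷ [])
    ∷ (core-# x y xy ∷ core-# x z xz ∷ x#t ∷ [])
    ∷ (core-# y z yz ∷ core-# y t yt ∷ [])
    ∷ (core-# z t zt ∷ [])
    ∷ [] ∷ [])

-- Four consecutive vertices of C₇(1,2) lack only the edge between their ends.
-- If 0 and 3 share a colour, then 3 and 6 do not, as 0 and 6 are adjacent.
lower₁ : ∀ m → 1 ≤ m → ∀ f → IsLocalAntimagic (A₁ ⋁ O m) f → 5 ≤ numColors (A₁ ⋁ O m) f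
lower₁ (suc m) _ f la = byEnds (v 0F ≟ℕ v 3F)
  where
  v : Fin 7 → ℕ
  v x = vsum (A₁ ⋁ O (suc m)) f (x ↑ˡ suc m)

  byEnds : Dec (v 0F ≡ v 3F) → 5 ≤ numColors (A₁ ⋁ O (suc m)) f
  byEnds (no  0#3) = diamond⇒5≤ A₁ m f la 0F 1F 2F 3F refl refl refl refl refl 0#3
  byEnds (yes 0≡3) = diamond⇒5≤ A₁ m f la 3F 4F 5F 6F refl refl refl refl refl
    (core-# A₁ m f la 0F 6F refl ∘ trans 0≡3)

lower₂ : ∀ m → 1 ≤ m → ∀ f → IsLocalAntimagic (A₂ ⋁ O m) f → 4 ≤ numColors (A₂ ⋁ O m) f
-- Vertex 0 lies on the 3-cycle and 3, 5 are opposite on the 4-cycle, so the three are pairwise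
-- adjacent in the complement.
lower₂ (suc m) _ f la = triangle⇒4≤ A₂ m f la 0F 3F 5F refl refl refl

-- Combining the three classes of k modulo 3.

module _ (G : Graph 7) (κ : ℕ) (size≡14 : size G ≡ 14) (W : Fin 3 → Vec (Vec ℕ 7) 7)
         (admissible : ∀ r → Admissible G r (W r)) (colours : ∀ r → length (baseColours G (W r) r) ≡ κ)
         (lower : ∀ m → 1 ≤ m → ∀ f → IsLocalAntimagic (G ⋁ O m) f → suc κ ≤ numColors (G ⋁ O m) f) where

  open Rectangle using (m)

  private
    -- The number of colours occurs in both the hypothesis and the conclusion of `chiLa-join`; this
    -- form lets `colours r` rewrite both at once.
    Goal : ℕ → ℕ → Set
    Goal m c = (∀ f → IsLocalAntimagic (G ⋁ O m) f → suc c ≤ numColors (G ⋁ O m) f) → ChiLa≡ (G ⋁ O m) (suc c)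

  chiLa-divMod : ∀ q (r : Fin 3) → 1 ≤ q * 3 + toℕ r → ChiLa≡ (G ⋁ O (m (q * 3 + toℕ r))) (suc κ)
  chiLa-divMod q r 1≤k = subst (Goal (m (q * 3 + toℕ r))) (colours r)
    (chiLa-join G size≡14 q r 1≤k (W r) (admissible r)) (lower (m (q * 3 + toℕ r)) (s≤s z≤n))

  chiLa : ∀ k → 1 ≤ k → ChiLa≡ (G ⋁ O (m k)) (suc κ)
  chiLa k = fromDivMod (k divMod 3)
    where
    fromDivMod : DivMod k 3 → 1 ≤ k → ChiLa≡ (G ⋁ O (m k)) (suc κ)
    -- `DivMod` puts the remainder first, hence the commutation; `1 ≤ k` is transported together
    -- with the conclusion.
    fromDivMod (result q r k≡) = subst (λ k → 1 ≤ k → ChiLa≡ (G ⋁ O (m k)) (suc κ))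
      (≡.sym (trans k≡ (+-comm (toℕ r) (q * 3)))) (chiLa-divMod q r)

theorem3p13 : ∀ (n : ℕ) → 2 ≤ n →
    ChiLa≡ (A₁ ⋁ O (2 * n ∸ 1)) 5 × ChiLa≡ (A₂ ⋁ O (2 * n ∸ 1)) 4
-- With n = k + 1, the number 2n - 1 of outer vertices is 2k + 1, and n ≥ 2 becomes k ≥ 1.
theorem3p13 (suc k) (s≤s 1≤k) =
  subst (λ m → ChiLa≡ (A₁ ⋁ O m) 5) (m≡2n∸1 k) (chiLa A₁ 4 refl weights₁ admissible₁ colours₁ lower₁ k 1≤k) ,
  subst (λ m → ChiLa≡ (A₂ ⋁ O m) 4) (m≡2n∸1 k) (chiLa A₂ 3 refl weights₂ admissible₂ colours₂ lower₂ k 1≤k)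
  where
  m≡2n∸1 : ∀ k → Rectangle.m k ≡ 2 * suc k ∸ 1
  m≡2n∸1 k = trans (≡.sym (+-suc k k)) (cong (λ l → k + suc l) (≡.sym (+-identityʳ k)))
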